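{- Let $\sigma$ be the two-dimensional substitution on the alphabet $\{1,2,3\}$ with base rule $$1\mapsto\{[(0,0),2],[(0,1),1]\},\qquad 2\mapsto\{[(0,0),3]\},\qquad 3\mapsto\{[(0,0),1]\},$$ and with the following 16 concatenation rules: $$\begin{array}{llll} (1,1,(1,0))\mapsto(0,2), & (1,2,(1,0))\mapsto(0,2), & (1,3,(1,0))\mapsto(0,2), & (2,1,(1,0))\mapsto(0,1),\\ (2,2,(1,0))\mapsto(0,1), & (3,1,(1,0))\mapsto(0,1), & (3,2,(1,0))\mapsto(0,1), & (3,3,(1,0))\mapsto(0,1),\\ (1,1,(0,1))\mapsto(-1,-1), & (1,2,(0,1))\mapsto(-1,0), & (1,3,(0,1))\mapsto(-1,0), & (2,1,(0,1))\mapsto(-1,-1),\\ (2,2,(0,1))\mapsto(-1,0), & (2,3,(0,1))\mapsto(-1,0), & (3,2,(0,1))\mapsto(-1,-1), & (3,3,(0,1))\mapsto(-1,-1). \end{array}$$ Then $\sigma$ is consistent and non-overlapping on $\mathrm{patt}(\mathcal{S}_{\mathrm{surf}})$, where $\mathcal{S}_{\mathrm{surf}}\subseteq\{1,2,3\}^{\mathbb{Z}^2}$ is the set of configurations all of whose $2\times 2$ patterns belong to the set $\mathcal{P}_{\mathrm{surf}}$ of 28 patterns listed in the context.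
   Context: **Cells and patterns.** Let $\mathcal{A}=\{1,2,3\}$. A cell is a pair $c=[v,t]$ with $v\in\mathbb{Z}^2$ (the vector of $c$) and $t\in\mathcal{A}$ (the type of $c$). A pattern is a finite set of cells with pairwise distinct vectors. Patterns are translated by elements of $\mathbb{Z}^2$ by translating the vectors of their cells. The support of $P$ is $\mathrm{supp}(P)=\{v:[v,t]\in P\}$. For $\mathcal{S}\subseteq\mathcal{A}^{\mathbb{Z}^2}$, $\mathrm{patt}(\mathcal{S})$ is the set of patterns $P$ that appear in the elements of $\mathcal{S}$, i.e. that can be extended to an element $x$ of $\mathcal{S}$ ($x_v=t$ for every $[v,t]\in P$). **The set $\mathcal{S}_{\mathrm{surf}}$.** Encode a $2\times2$ pattern $\{[v,a],[v+(1,0),b],[v+(0,1),c],[v+(1,1),d]\}$ by the word $abcd$ (bottom-left, bottom-right, top-left, top-right). $\mathcal{P}_{\mathrm{surf}}$ consists of the 28 patterns 1111, 1121, 1131, 1211, 1221, 1231, 1312, 1313, 1322, 1332, 1333, 2112, 2113, 2122, 2132, 2133, 2212, 2213, 2222, 2232, 2233, 3121, 3131, 3221, 3231, 3322, 3332, 3333. **Substitutions.** A two-dimensional substitution $\sigma$ on $\mathcal{A}$ consists of a base rule, i.e. a map $\sigma_{\mathrm{base}}$ from $\mathcal{A}$ to the set of patterns, and a finite set of concatenation rules $(t,t',u)\mapsto v$ with $t,t'\in\mathcal{A}$, $u,v\in\mathbb{Z}^2$. For a cell $c=[v,t]$ put $\sigma_{\mathrm{base}}(c)=\sigma_{\mathrm{base}}(t)$.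 The set of starting patterns of $\sigma$ is $\mathcal{C}_\sigma=\{\{[0,t],[u,t']\} : (t,t',u)\mapsto v \text{ is a rule of } \sigma \text{ for some } v\}$. For cells $c=[u,t]$, $c'=[u',t']$, set $\sigma_{\mathrm{rule}}(c,c')=v$ if $(t,t',u'-u)\mapsto v$ is a rule of $\sigma$, $\sigma_{\mathrm{rule}}(c,c')=-v$ if $(t',t,u-u')\mapsto v$ is a rule of $\sigma$, and leave it undefined otherwise. **Paths.** A $\mathcal{C}_\sigma$-path from $c_1$ to $c_n$ is a finite sequence of cells $\gamma=(c_1,\dots,c_n)$ such that $\{c_i,c_{i+1}\}$ is a translate of an element of $\mathcal{C}_\sigma$ for all $1\le i\le n-1$, and such that $c_i=c_j$ whenever $c_i$ and $c_j$ have the same vector. It is a $\mathcal{C}_\sigma$-path of a pattern $P$ if all its cells belong to $P$. A pattern $P$ is $\mathcal{C}_\sigma$-covered if for all $c,c'\in P$ there is a $\mathcal{C}_\sigma$-path of $P$ from $c$ to $c'$. The image vector of $\gamma$ is $\omega_\sigma(\gamma)=\sum_{i=1}^{n-1}\sigma_{\mathrm{rule}}(c_i,c_{i+1})$. **Consistency and overlapping.** Let $P$ be a $\mathcal{C}_\sigma$-covered pattern. $\sigma$ is consistent on $P$ if for all cells $c,c'\in P$ and all $\mathcal{C}_\sigma$-paths $\gamma,\gamma'$ of $P$ from $c$ to $c'$ we have $\omega_\sigma(\gamma)=\omega_\sigma(\gamma')$. $\sigma$ is non-overlapping on $P$ if for all cells $c\neq c'$ of $P$ and every $\mathcal{C}_\sigma$-path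 $\gamma$ of $P$ from $c$ to $c'$ we have $\mathrm{supp}(\sigma_{\mathrm{base}}(c))\cap \mathrm{supp}(\omega_\sigma(\gamma)+\sigma_{\mathrm{base}}(c'))=\varnothing$. $\sigma$ is consistent (resp. non-overlapping) on a set of patterns if it is so on every $\mathcal{C}_\sigma$-covered pattern belonging to that set. -}

module Defs where

open import Data.Fin.Base using (Fin)
open import Data.Fin.Patterns using (0F; 1F; 2F)
import Data.Fin.Properties as Fin
open import Data.Integer.Base using (ℤ; +_; -1ℤ; 0ℤ; 1ℤ)
import Data.Integer.Base as ℤ
import Data.Integer.Properties as ℤ
open import Algebra.Properties.AbelianGroup ℤ.+-0-abelianGroup using (xyx⁻¹≈y; ∙-cancelˡ)
open import Data.List.Base using (List; []; _∷_; map)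
open import Data.List.Membership.Propositional using (_∈_; lose)
open import Data.List.Relation.Binary.BagAndSetEquality using (_∼[_]_; set)
open import Data.List.Relation.Binary.Disjoint.Propositional using (Disjoint)
open import Data.List.Relation.Unary.All using (All)
import Data.List.Relation.Unary.AllPairs as AllPairs using (map)
import Data.List.Relation.Unary.AllPairs.Properties as AllPairs
open import Data.List.Relation.Unary.Any as Any using (here; there; any?)
open import Data.List.Relation.Unary.Unique.Propositional using (Unique)
open import Data.List.Relation.Unary.Unique.DecPropositional using (unique?)
open import Data.Maybe.Base as Maybe using (Maybe; just; nothing; _<∣>_)
open import Data.Maybe using (Is-just; to-witness)
import Data.Maybe.Relation.Unary.Any as MaybeAny
open import Data.Product.Base using (_×_; _,_; ∃-syntax; proj₁; proj₂)
open import Data.Product.Properties using (≡-dec)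
open import Data.Sum.Base using (_⊎_; inj₁; inj₂)
open import Data.Unit.Base using (tt)
open import Function.Bundles using (Equivalence)
open import Relation.Binary.Construct.Closure.ReflexiveTransitive using (Star; ε; _◅_)
open import Relation.Binary.Definitions using (DecidableEquality)
open import Relation.Binary.PropositionalEquality using (_≡_; _≢_; refl; sym; trans; cong; cong₂; subst)
open import Relation.Nullary.Decidable using (yes; no; from-yes)
open import Relation.Nullary.Negation using (contradiction)
open import Relation.Unary using (Pred)
import Relation.Unary as Unary
open import Level using (0ℓ)

Vector : Set
Vector = ℤ × ℤ

infixl 6 _⊕_ _⊖_

𝟎 : Vector
𝟎 = 0ℤ , 0ℤ

_⊕_ : Vector → Vector → Vector
(a , b) ⊕ (c , d) = a ℤ.+ c , b ℤ.+ d

⊝_ : Vector → Vector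
⊝ (a , b) = ℤ.- a , ℤ.- b

_⊖_ : Vector → Vector → Vector
u ⊖ v = u ⊕ ⊝ v

Letter : Set
Letter = Fin 3

pattern ① = 0F
pattern ② = 1F
pattern ③ = 2F

record Cell : Set where
  constructor [_,_]
  field
    vec  : Vector
    type : Letter

open Cell public

record Pattern : Set where
  constructor mkPattern
  field
    cells    : List Cell
    distinct : Unique (map vec cells)

open Pattern public

infix 4 _∈ᴾ_

_∈ᴾ_ : Cell → Pattern → Set
c ∈ᴾ P = c ∈ cells P

supp : Pattern → List Vector
supp P = map vec (cells P)

infixr 7 _+ᶜ_ _+ᴾ_

_+ᶜ_ : Vector → Cell → Cell
w +ᶜ [ v , t ] = [ w ⊕ v , t ]

⊕-cancelˡ : ∀ w {u v} → w ⊕ u ≡ w ⊕ v → u ≡ v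
⊕-cancelˡ (a , b) {c , d} {c′ , d′} eq =
  cong₂ _,_ (∙-cancelˡ a c c′ (cong proj₁ eq)) (∙-cancelˡ b d d′ (cong proj₂ eq))

_+ᴾ_ : Vector → Pattern → Pattern
w +ᴾ mkPattern cs d = mkPattern (map (w +ᶜ_) cs)
  (AllPairs.map⁺ (AllPairs.map⁺
    (AllPairs.map (λ ne eq → ne (⊕-cancelˡ w eq)) (AllPairs.map⁻ d))))

Configuration : Set
Configuration = Vector → Letter

patt : Pred Configuration 0ℓ → Pred Pattern 0ℓ
patt S P = ∃[ x ] S x × All (λ c → x (vec c) ≡ type c) (cells P)

-- Words abcd: bottom-left, bottom-right, top-left, top-right.
Word : Set
Word = Letter × Letter × Letter × Letter

wordAt : Configuration → Vector → Word
wordAt x v = x v , x (v ⊕ (1ℤ , 0ℤ)) , x (v ⊕ (0ℤ , 1ℤ)) , x (v ⊕ (1ℤ , 1ℤ))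

P-surf : List Word
P-surf =
  (① , ① , ① , ①) ∷ (① , ① , ② , ①) ∷ (① , ① , ③ , ①) ∷ (① , ② , ① , ①) ∷
  (① , ② , ② , ①) ∷ (① , ② , ③ , ①) ∷ (① , ③ , ① , ②) ∷ (① , ③ , ① , ③) ∷
  (① , ③ , ② , ②) ∷ (① , ③ , ③ , ②) ∷ (① , ③ , ③ , ③) ∷ (② , ① , ① , ②) ∷
  (② , ① , ① , ③) ∷ (② , ① , ② , ②) ∷ (② , ① , ③ , ②) ∷ (② , ① , ③ , ③) ∷
  (② , ② , ① , ②) ∷ (② , ② , ① , ③) ∷ (② , ② , ② , ②) ∷ (② , ② , ③ , ②) ∷
  (② , ② , ③ , ③) ∷ (③ , ① , ② , ①) ∷ (③ , ① , ③ , ①) ∷ (③ , ② , ② , ①) ∷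
  (③ , ② , ③ , ①) ∷ (③ , ③ , ② , ②) ∷ (③ , ③ , ③ , ②) ∷ (③ , ③ , ③ , ③) ∷ []

S-surf : Pred Configuration 0ℓ
S-surf x = ∀ v → wordAt x v ∈ P-surf

RuleKey : Set
RuleKey = Letter × Letter × Vector

_≟ᴷ_ : DecidableEquality RuleKey
_≟ᴷ_ = ≡-dec Fin._≟_ (≡-dec Fin._≟_ (≡-dec ℤ._≟_ ℤ._≟_))

infix 5 _↦_

record Rule : Set where
  constructor _↦_
  field
    key   : RuleKey
    image : Vector

open Rule public

-- The field `functional` says that the rules form a finite partial map.
record Substitution : Set where
  field
    base       : Letter → Pattern
    rules      : List Rule
    functional : Unique (map key rules)

module _ (σ : Substitution) where
  open Substitution σ

  lookupRule : RuleKey → Maybe Vector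
  lookupRule k with any? (λ r → k ≟ᴷ key r) rules
  ... | yes k∈ = just (image (Any.lookup k∈))
  ... | no  _  = nothing

  ruleValue : Cell → Cell → Maybe Vector
  ruleValue [ u , t ] [ u′ , t′ ] =
    lookupRule (t , t′ , u′ ⊖ u) <∣> Maybe.map ⊝_ (lookupRule (t′ , t , u ⊖ u′))

  -- Unordered pairs of cells are lists, compared below up to set equality.
  Starting : Pred (List Cell) 0ℓ
  Starting Q = ∃[ t ] ∃[ t′ ] ∃[ u ] ∃[ v ]
    ((t , t′ , u) ↦ v) ∈ rules × Q ≡ [ 𝟎 , t ] ∷ [ u , t′ ] ∷ []

  Adjacent : Cell → Cell → Set
  Adjacent c c′ = ∃[ Q ] Starting Q × ∃[ w ] (c ∷ c′ ∷ []) ∼[ set ] map (w +ᶜ_) Q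

  private
    lookupRule-defined : ∀ {k v} → (k ↦ v) ∈ rules → Is-just (lookupRule k)
    lookupRule-defined {k} k∈ with any? (λ r → k ≟ᴷ key r) rules
    ... | yes _  = MaybeAny.just tt
    ... | no  k∉ = contradiction (lose k∈ refl) k∉

    <∣>-definedˡ : ∀ {m n : Maybe Vector} → Is-just m → Is-just (m <∣> n)
    <∣>-definedˡ (MaybeAny.just _) = MaybeAny.just tt

    <∣>-definedʳ : ∀ (m : Maybe Vector) {n} → Is-just n → Is-just (m <∣> Maybe.map ⊝_ n)
    <∣>-definedʳ (just _) _                 = MaybeAny.just tt
    <∣>-definedʳ nothing  (MaybeAny.just _) = MaybeAny.just tt

    difference : ∀ w u → (w ⊕ u) ⊖ (w ⊕ 𝟎) ≡ u
    difference (a , b) (c , d) = cong₂ _,_ (lemma a c) (lemma b d)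
      where
      lemma : ∀ a c → (a ℤ.+ c) ℤ.+ ℤ.- (a ℤ.+ 0ℤ) ≡ c
      lemma a c = trans (cong (λ z → (a ℤ.+ c) ℤ.+ ℤ.- z) (ℤ.+-identityʳ a)) (xyx⁻¹≈y a c)

    unorderedPair : ∀ {c c′ d d′ : Cell} → (c ∷ c′ ∷ []) ∼[ set ] (d ∷ d′ ∷ []) →
                    (c ≡ d × c′ ≡ d′) ⊎ (c ≡ d′ × c′ ≡ d)
    unorderedPair eq
      with Equivalence.to eq (here refl) | Equivalence.to eq (there (here refl))
    ... | here p         | there (here q) = inj₁ (p , q)
    ... | there (here p) | here q         = inj₂ (p , q)
    ... | here refl | here refl with Equivalence.from eq (there (here refl))
    ...   | here p         = inj₁ (refl , sym p)
    ...   | there (here p) = inj₁ (refl , sym p)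
    unorderedPair eq | there (here refl) | there (here refl)
      with Equivalence.from eq (here refl)
    ...   | here p         = inj₁ (sym p , refl)
    ...   | there (here p) = inj₁ (sym p , refl)

  -- Hence image vectors of paths are total, although ruleValue is partial.
  ruleValue-defined : ∀ {c c′} → Adjacent c c′ → Is-just (ruleValue c c′)
  ruleValue-defined (_ , (t , t′ , u , v , r∈ , refl) , w , eq) with unorderedPair eq
  ... | inj₁ (refl , refl) = <∣>-definedˡ
        (subst (λ z → Is-just (lookupRule (t , t′ , z))) (sym (difference w u))
               (lookupRule-defined r∈))
  ... | inj₂ (refl , refl) = <∣>-definedʳ (lookupRule (t′ , t , (w ⊕ 𝟎) ⊖ (w ⊕ u)))
        (subst (λ z → Is-just (lookupRule (t , t′ , z))) (sym (difference w u))
               (lookupRule-defined r∈))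

  -- A sequence (c₁,…,cₙ) is an element of Star Adjacent c₁ cₙ; ε is the case n = 1.

  cellsOf : ∀ {c c′} → Star Adjacent c c′ → List Cell
  cellsOf {c} ε       = c ∷ []
  cellsOf {c} (_ ◅ γ) = c ∷ cellsOf γ

  record Path (c c′ : Cell) : Set where
    constructor mkPath
    field
      steps      : Star Adjacent c c′
      compatible : ∀ {d d′} → d ∈ cellsOf steps → d′ ∈ cellsOf steps →
                   vec d ≡ vec d′ → d ≡ d′

  open Path public

  PathOf : Pattern → Cell → Cell → Set
  PathOf P c c′ = ∃[ γ ] All (_∈ᴾ P) (cellsOf (steps {c} {c′} γ))

  Covered : Pred Pattern 0ℓ
  Covered P = ∀ {c c′} → c ∈ᴾ P → c′ ∈ᴾ P → PathOf P c c′

  sumSteps : ∀ {c c′} → Star Adjacent c c′ → Vector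
  sumSteps ε       = 𝟎
  sumSteps (a ◅ γ) = to-witness (ruleValue-defined a) ⊕ sumSteps γ

  ω : ∀ {P c c′} → PathOf P c c′ → Vector
  ω (γ , _) = sumSteps (steps γ)

  ConsistentAt : Pred Pattern 0ℓ
  ConsistentAt P = ∀ {c c′} → c ∈ᴾ P → c′ ∈ᴾ P →
    (γ γ′ : PathOf P c c′) → ω {P} γ ≡ ω {P} γ′

  NonOverlappingAt : Pred Pattern 0ℓ
  NonOverlappingAt P = ∀ {c c′} → c ∈ᴾ P → c′ ∈ᴾ P → c ≢ c′ → (γ : PathOf P c c′) →
    Disjoint (supp (base (type c))) (supp (ω {P} γ +ᴾ base (type c′)))

  ConsistentOn : Pred Pattern 0ℓ → Set
  ConsistentOn 𝒫 = ∀ P → P Unary.∈ 𝒫 → Covered P → ConsistentAt P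

  NonOverlappingOn : Pred Pattern 0ℓ → Set
  NonOverlappingOn 𝒫 = ∀ P → P Unary.∈ 𝒫 → Covered P → NonOverlappingAt P

private
  _≟ⱽ_ : DecidableEquality Vector
  _≟ⱽ_ = ≡-dec ℤ._≟_ ℤ._≟_

σ-base : Letter → Pattern
σ-base ① = mkPattern ([ (0ℤ , 0ℤ) , ② ] ∷ [ (0ℤ , 1ℤ) , ① ] ∷ [])
                     (from-yes (unique? _≟ⱽ_ ((0ℤ , 0ℤ) ∷ (0ℤ , 1ℤ) ∷ [])))
σ-base ② = mkPattern ([ (0ℤ , 0ℤ) , ③ ] ∷ []) (from-yes (unique? _≟ⱽ_ ((0ℤ , 0ℤ) ∷ [])))
σ-base ③ = mkPattern ([ (0ℤ , 0ℤ) , ① ] ∷ []) (from-yes (unique? _≟ⱽ_ ((0ℤ , 0ℤ) ∷ [])))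

σ-rules : List Rule
σ-rules =
  ((① , ① , 1ℤ , 0ℤ) ↦ (0ℤ , + 2)) ∷
  ((① , ② , 1ℤ , 0ℤ) ↦ (0ℤ , + 2)) ∷
  ((① , ③ , 1ℤ , 0ℤ) ↦ (0ℤ , + 2)) ∷
  ((② , ① , 1ℤ , 0ℤ) ↦ (0ℤ , 1ℤ)) ∷
  ((② , ② , 1ℤ , 0ℤ) ↦ (0ℤ , 1ℤ)) ∷
  ((③ , ① , 1ℤ , 0ℤ) ↦ (0ℤ , 1ℤ)) ∷
  ((③ , ② , 1ℤ , 0ℤ) ↦ (0ℤ , 1ℤ)) ∷
  ((③ , ③ , 1ℤ , 0ℤ) ↦ (0ℤ , 1ℤ)) ∷
  ((① , ① , 0ℤ , 1ℤ) ↦ (-1ℤ , -1ℤ)) ∷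
  ((① , ② , 0ℤ , 1ℤ) ↦ (-1ℤ , 0ℤ)) ∷
  ((① , ③ , 0ℤ , 1ℤ) ↦ (-1ℤ , 0ℤ)) ∷
  ((② , ① , 0ℤ , 1ℤ) ↦ (-1ℤ , -1ℤ)) ∷
  ((② , ② , 0ℤ , 1ℤ) ↦ (-1ℤ , 0ℤ)) ∷
  ((② , ③ , 0ℤ , 1ℤ) ↦ (-1ℤ , 0ℤ)) ∷
  ((③ , ② , 0ℤ , 1ℤ) ↦ (-1ℤ , -1ℤ)) ∷
  ((③ , ③ , 0ℤ , 1ℤ) ↦ (-1ℤ , -1ℤ)) ∷ []

σ-surf : Substitution
σ-surf = record
  { base       = σ-base
  ; rules      = σ-rules
  ; functional = from-yes (unique? _≟ᴷ_ (map key σ-rules))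
  }

{-# OPTIONS --safe #-}

-- Telescoping along a path, σ is consistent as soon as the images of its rules are the increments
-- Φ(u′) − Φ(u) of a function Φ on ℤ². For each of the 28 words of P-surf the rule images have the
-- same sum along the two ways around the square, so such a Φ exists for every configuration of
-- S-surf. Its first coordinate is minus the row index, so images of cells in different rows are
-- disjoint; along a row the second coordinate increases at each cell by the height of the image
-- of that cell, so images of distinct cells in one row are disjoint as well.
module Submission where

open import Defs
open import Data.Integer.Base using (ℤ; +_; -[1+_]; +[1+_]; 0ℤ; 1ℤ; -1ℤ; _+_; -_; ∣_∣;
  _≤_; _<_; +≤+; +<+)
import Data.Integer.Properties as ℤ
open import Algebra.Properties.AbelianGroup ℤ.+-0-abelianGroup using (∙-cancelʳ)
open import Data.Integer.Tactic.RingSolver using (solve-∀)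
open import Data.List.Membership.Propositional using (_∈_)
open import Data.List.Membership.Propositional.Properties using (∈-map⁺; ∈-map⁻)
open import Data.List.Relation.Unary.All as All using (All; []; _∷_)
open import Data.List.Relation.Unary.Any using (here; there; any?)
open import Data.Maybe using (Maybe; Is-just; to-witness)
import Data.Maybe.Relation.Unary.All as MaybeAll
import Data.Maybe.Relation.Unary.All.Properties as MaybeAll
import Data.Maybe.Relation.Unary.Any as MaybeAny
open import Data.Nat.Base using (zero; suc; z≤n; s≤s)
open import Data.Product.Base using (_×_; _,_; ∃-syntax; proj₁; proj₂)
open import Relation.Binary.Construct.Closure.ReflexiveTransitive using (Star; ε; _◅_)
open import Relation.Binary.Definitions using (tri<; tri≈; tri>)
open import Relation.Binary.PropositionalEquality
  using (_≡_; _≢_; refl; sym; trans; cong; cong₂; subst; subst₂; module ≡-Reasoning)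
open import Relation.Nullary.Decidable using (yes; no; from-yes)
open import Relation.Nullary.Negation using (contradiction)

-- Arithmetic of vectors and translates.

⊕-identityʳ : ∀ u → u ⊕ 𝟎 ≡ u
⊕-identityʳ (a , b) = cong₂ _,_ (ℤ.+-identityʳ a) (ℤ.+-identityʳ b)

⊕-assoc : ∀ u v w → (u ⊕ v) ⊕ w ≡ u ⊕ (v ⊕ w)
⊕-assoc (a , b) (c , d) (e , f) = cong₂ _,_ (ℤ.+-assoc a c e) (ℤ.+-assoc b d f)

u⊕[v⊖u]≡v : ∀ u v → u ⊕ (v ⊖ u) ≡ v
u⊕[v⊖u]≡v (a , b) (c , d) = cong₂ _,_ (lemma a c) (lemma b d)
  where
  lemma : ∀ a c → a + (c + - a) ≡ c
  lemma = solve-∀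

[u⊕v]⊖v≡u : ∀ u v → (u ⊕ v) ⊖ v ≡ u
[u⊕v]⊖v≡u (a , b) (c , d) = cong₂ _,_ (lemma a c) (lemma b d)
  where
  lemma : ∀ a c → a + c + - c ≡ a
  lemma = solve-∀

∈-translate : ∀ w P {z} → z ∈ supp (w +ᴾ P) → ∃[ z′ ] z′ ∈ supp P × z ≡ w ⊕ z′
∈-translate w P z∈
  with _ , d∈ , refl ← ∈-map⁻ vec z∈
  with c , c∈ , refl ← ∈-map⁻ (w +ᶜ_) d∈ = vec c , ∈-map⁺ vec c∈ , refl

-- Potentials, telescoping and consistency.

IsPotential : Substitution → Configuration → (Vector → Vector) → Set
IsPotential σ x Φ = All Increment (Substitution.rules σ)
  where
  Increment : Rule → Set
  Increment ((t , t′ , d) ↦ v) = ∀ u → x u ≡ t → x (u ⊕ d) ≡ t′ → Φ (u ⊕ d) ≡ Φ u ⊕ v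

Agrees : Configuration → Cell → Set
Agrees x c = x (vec c) ≡ type c

lookupRule-All : ∀ σ {Q : Vector → Set} k →
                 All (λ r → k ≡ key r → Q (image r)) (Substitution.rules σ) →
                 MaybeAll.All Q (lookupRule σ k)
lookupRule-All σ k qs with any? (λ r → k ≟ᴷ key r) (Substitution.rules σ)
... | no  _  = MaybeAll.nothing
... | yes k∈ with q , eq ← All.lookupAny qs k∈ = MaybeAll.just (q eq)

-- Facts about rule values are stated on `Maybe`, while image vectors sum the witnesses; this passes
-- from one to the other.
to-witness-All : ∀ {A : Set} {Q : A → Set} {m : Maybe A} → MaybeAll.All Q m →
                 (j : Is-just m) → Q (to-witness j)
to-witness-All (MaybeAll.just q) (MaybeAny.just _) = q

source∈cellsOf : ∀ {σ c c′} (γ : Star (Adjacent σ) c c′) → c ∈ cellsOf σ γ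
source∈cellsOf ε       = here refl
source∈cellsOf (_ ◅ _) = here refl

module _ {σ x} Φ (potential : IsPotential σ x Φ) where

  lookupRule-increment : ∀ {u u′ t t′} → x u ≡ t → x u′ ≡ t′ →
                         MaybeAll.All (λ v → Φ u′ ≡ Φ u ⊕ v) (lookupRule σ (t , t′ , u′ ⊖ u))
  lookupRule-increment {u} {u′} xu xu′ = lookupRule-All σ _ (All.map
    -- Equality of keys makes `u′ ⊖ u` the displacement of the rule, which therefore leads from `u`
    -- to `u′`.
    (λ { inc refl → subst (λ z → x z ≡ _ → Φ z ≡ _) (u⊕[v⊖u]≡v u u′) (inc u xu) xu′ })
    potential)

  ruleValue-increment : ∀ {c c′} → Agrees x c → Agrees x c′ →
                        MaybeAll.All (λ v → Φ (vec c′) ≡ Φ (vec c) ⊕ v) (ruleValue σ c c′)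
  ruleValue-increment {c} {c′} xc xc′ = MaybeAll.<∣>⁺
    (lookupRule-increment xc xc′)
    (MaybeAll.map⁺ (MaybeAll.map
      -- A rule read backwards contributes `⊝ v`: the equation `Φ (vec c) ≡ Φ (vec c′) ⊕ v` is
      -- solved for `Φ (vec c′)`.
      (λ {v} eq → trans (sym ([u⊕v]⊖v≡u (Φ (vec c′)) v)) (cong (_⊖ v) (sym eq)))
      (lookupRule-increment xc′ xc)))

  sumSteps-increment : ∀ {c c′} (γ : Star (Adjacent σ) c c′) → All (Agrees x) (cellsOf σ γ) →
                       Φ (vec c′) ≡ Φ (vec c) ⊕ sumSteps σ γ
  sumSteps-increment {c} ε _ = sym (⊕-identityʳ (Φ (vec c)))
  sumSteps-increment {c} {c′} (_◅_ {j = d} a γ) (xc ∷ xs) = begin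
    Φ (vec c′)                       ≡⟨ sumSteps-increment γ xs ⟩
    Φ (vec d) ⊕ sumSteps σ γ         ≡⟨ cong (_⊕ sumSteps σ γ) step ⟩
    (Φ (vec c) ⊕ v) ⊕ sumSteps σ γ   ≡⟨ ⊕-assoc (Φ (vec c)) v (sumSteps σ γ) ⟩
    Φ (vec c) ⊕ (v ⊕ sumSteps σ γ)   ∎
    where
    open ≡-Reasoning
    v = to-witness (ruleValue-defined σ a)
    step : Φ (vec d) ≡ Φ (vec c) ⊕ v
    step = to-witness-All (ruleValue-increment xc (All.lookup xs (source∈cellsOf γ)))
                          (ruleValue-defined σ a)

  ω-increment : ∀ P → All (Agrees x) (cells P) → ∀ {c c′} (γ : PathOf σ P c c′) →
                Φ (vec c′) ≡ Φ (vec c) ⊕ ω σ {P} γ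
  ω-increment P xP (γ , γ∈P) = sumSteps-increment (steps γ) (All.map (All.lookup xP) γ∈P)

  -- Either image vector is the difference of `Φ` between the endpoints, which does not see the
  -- path.
  potential⇒consistent : ∀ P → All (Agrees x) (cells P) → ConsistentAt σ P
  potential⇒consistent P xP {c} _ _ γ γ′ = ⊕-cancelˡ (Φ (vec c))
    (trans (sym (ω-increment P xP γ)) (ω-increment P xP γ′))

-- Sums over integer intervals.

-- The sum of f over [0, i), and minus its sum over [i, 0) for i < 0.
∑ : (ℤ → ℤ) → ℤ → ℤ
∑ f (+ zero)      = 0ℤ
∑ f +[1+ n ]      = ∑ f (+ n) + f (+ n)
∑ f -[1+ zero ]   = - f -1ℤ
∑ f -[1+ suc n ]  = ∑ f -[1+ n ] + - f -[1+ suc n ]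

∑-suc : ∀ f i → ∑ f (i + 1ℤ) ≡ ∑ f i + f i
-- `1ℤ + i` reduces in each case of `lemma`, whereas `+ n + 1ℤ` is stuck.
∑-suc f i rewrite ℤ.+-comm i 1ℤ = lemma i
  where
  cancel : ∀ a b → a ≡ a + - b + b
  cancel = solve-∀
  lemma : ∀ i → ∑ f (1ℤ + i) ≡ ∑ f i + f i
  lemma (+ n)         = refl
  lemma -[1+ zero ]   = sym (ℤ.+-inverseˡ (f -1ℤ))
  lemma -[1+ suc n ]  = cancel (∑ f -[1+ n ]) (f -[1+ suc n ])

-- Both steps concern the same pair `i`, `i + 1ℤ`, so one identity between neighbouring columns can
-- serve both directions.
ℤ-induction : (P : ℤ → Set) → P 0ℤ → (∀ i → P i → P (i + 1ℤ)) → (∀ i → P (i + 1ℤ) → P i) →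
              ∀ i → P i
ℤ-induction P p₀ up down = go
  where
  go : ∀ i → P i
  go (+ zero)     = p₀
  go +[1+ n ]     = subst P (ℤ.+-comm (+ n) 1ℤ) (up (+ n) (go (+ n)))
  go -[1+ zero ]  = down -1ℤ p₀
  go -[1+ suc n ] = down -[1+ suc n ] (go -[1+ n ])

∑-mono-≤ : ∀ f → (∀ i → 0ℤ ≤ f i) → ∀ {i j} → i ≤ j → ∑ f i ≤ ∑ f j
∑-mono-≤ f f≥0 {i} {j} i≤j =
  -- Induction on the distance from `i` to `j` avoids cases on their signs.
  subst (λ k → ∑ f i ≤ ∑ f k) endpoint (go ∣ j + - i ∣)
  where
  ends : ∀ i j → i + (j + - i) ≡ j
  ends = solve-∀
  endpoint : i + + ∣ j + - i ∣ ≡ j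
  endpoint = trans (cong (λ d → i + d) (ℤ.0≤i⇒+∣i∣≡i (ℤ.i≤j⇒0≤j-i i≤j))) (ends i j)
  next : ∀ i n → i + (1ℤ + n) ≡ i + n + 1ℤ
  next = solve-∀
  go : ∀ n → ∑ f i ≤ ∑ f (i + + n)
  go zero    = ℤ.≤-reflexive (cong (∑ f) (sym (ℤ.+-identityʳ i)))
  go (suc n) = begin
    ∑ f i                            ≤⟨ go n ⟩
    ∑ f (i + + n)                    ≡⟨ ℤ.+-identityʳ _ ⟨
    ∑ f (i + + n) + 0ℤ               ≤⟨ ℤ.+-monoʳ-≤ (∑ f (i + + n)) (f≥0 _) ⟩
    ∑ f (i + + n) + f (i + + n)      ≡⟨ ∑-suc f (i + + n) ⟨
    ∑ f (i + + n + 1ℤ)               ≡⟨ cong (∑ f) (next i (+ n)) ⟨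
    ∑ f (i + + suc n)                ∎
    where open ℤ.≤-Reasoning

∑-mono-< : ∀ f → (∀ i → 0ℤ ≤ f i) → ∀ {i j} → i < j → ∑ f i + f i ≤ ∑ f j
∑-mono-< f f≥0 {i} {j} i<j = begin
  ∑ f i + f i     ≡⟨ ∑-suc f i ⟨
  ∑ f (i + 1ℤ)    ≡⟨ cong (∑ f) (ℤ.+-comm i 1ℤ) ⟩
  ∑ f (1ℤ + i)    ≤⟨ ∑-mono-≤ f f≥0 (ℤ.i<j⇒suc[i]≤j i<j) ⟩
  ∑ f j           ∎
  where open ℤ.≤-Reasoning

-- A discrete Poincaré lemma on the grid.

module _ (h v : ℤ → ℤ → ℤ) (closed : ∀ i j → h i j + v (i + 1ℤ) j ≡ v i j + h i (j + 1ℤ)) where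

  -- Summation along one fixed lattice path from the origin: along column 0 to row `j`, then along
  -- that row. Horizontal increments are then right by construction.
  integral : ℤ → ℤ → ℤ
  integral i j = ∑ (v 0ℤ) j + ∑ (λ k → h k j) i

  integral-horizontal : ∀ i j → integral (i + 1ℤ) j ≡ integral i j + h i j
  integral-horizontal i j = trans
    (cong (λ d → ∑ (v 0ℤ) j + d) (∑-suc (λ k → h k j) i))
    (sym (ℤ.+-assoc (∑ (v 0ℤ) j) _ _))

  -- In column 0 this is the recursion of `∑`; closedness of the unit squares between rows `j` and
  -- `j + 1ℤ` carries it from column to column.
  integral-vertical : ∀ i j → integral i (j + 1ℤ) ≡ integral i j + v i j
  integral-vertical i j = ℤ-induction P p₀ up down i
    where
    P : ℤ → Set
    P i = integral i (j + 1ℤ) ≡ integral i j + v i j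
    p₀ : P 0ℤ
    p₀ = begin
      ∑ (v 0ℤ) (j + 1ℤ) + 0ℤ         ≡⟨ cong (_+ 0ℤ) (∑-suc (v 0ℤ) j) ⟩
      ∑ (v 0ℤ) j + v 0ℤ j + 0ℤ       ≡⟨ swap (∑ (v 0ℤ) j) (v 0ℤ j) ⟩
      ∑ (v 0ℤ) j + 0ℤ + v 0ℤ j       ∎
      where
      open ≡-Reasoning
      swap : ∀ a b → a + b + 0ℤ ≡ a + 0ℤ + b
      swap = solve-∀
    around : ∀ i → integral (i + 1ℤ) j + v (i + 1ℤ) j ≡ integral i j + v i j + h i (j + 1ℤ)
    around i = begin
      integral (i + 1ℤ) j + v (i + 1ℤ) j     ≡⟨ cong (_+ v (i + 1ℤ) j) (integral-horizontal i j) ⟩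
      integral i j + h i j + v (i + 1ℤ) j    ≡⟨ ℤ.+-assoc (integral i j) _ _ ⟩
      integral i j + (h i j + v (i + 1ℤ) j)  ≡⟨ cong (λ d → integral i j + d) (closed i j) ⟩
      integral i j + (v i j + h i (j + 1ℤ))  ≡⟨ ℤ.+-assoc (integral i j) _ _ ⟨
      integral i j + v i j + h i (j + 1ℤ)    ∎
      where open ≡-Reasoning
    up : ∀ i → P i → P (i + 1ℤ)
    up i p = trans (integral-horizontal i (j + 1ℤ))
      (trans (cong (_+ h i (j + 1ℤ)) p) (sym (around i)))
    down : ∀ i → P (i + 1ℤ) → P i
    -- Cancelling the top edge of the square runs `up` backwards.
    down i p = ∙-cancelʳ (h i (j + 1ℤ)) _ _
      (trans (sym (integral-horizontal i (j + 1ℤ))) (trans p (around i)))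

-- Rule images of σ and the 28 words.

-- Two quantities coincide here: the second coordinate of the horizontal rules with this left
-- letter, and the number of cells stacked in its base image.
height : Letter → ℤ
height ① = + 2
height ② = 1ℤ
height ③ = 1ℤ

-- There is no vertical rule for (③ , ①): its value here is arbitrary.
rise : Letter → Letter → ℤ
rise ① ① = -1ℤ
rise ① _ = 0ℤ
rise ② ① = -1ℤ
rise ② _ = 0ℤ
rise ③ _ = -1ℤ

height≥0 : ∀ t → 0ℤ ≤ height t
height≥0 ① = +≤+ z≤n
height≥0 ② = +≤+ z≤n
height≥0 ③ = +≤+ z≤n

supp-base : ∀ t {z} → z ∈ supp (σ-base t) → proj₁ z ≡ 0ℤ × 0ℤ ≤ proj₂ z × proj₂ z < height t
supp-base ① (here refl)         = refl , +≤+ z≤n , +<+ (s≤s z≤n)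
supp-base ① (there (here refl)) = refl , +≤+ z≤n , +<+ (s≤s (s≤s z≤n))
supp-base ② (here refl)         = refl , +≤+ z≤n , +<+ (s≤s z≤n)
supp-base ③ (here refl)         = refl , +≤+ z≤n , +<+ (s≤s z≤n)

-- Right then up against up then right. Only second coordinates are compared, since the first
-- coordinate of a rule image depends on its direction alone.
ClosedWord : Word → Set
ClosedWord (a , b , c , d) = height a + rise b d ≡ rise a c + height c

P-surf-closed : All ClosedWord P-surf
P-surf-closed = from-yes
  (All.all? (λ (a , b , c , d) → height a + rise b d ℤ.≟ rise a c + height c) P-surf)

-- The potential of a configuration and the disjointness of images.

module Surface {x} (x∈S : S-surf x) where

  h v : ℤ → ℤ → ℤ
  h i j = height (x (i , j))
  v i j = rise (x (i , j)) (x (i , j + 1ℤ))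

  closed : ∀ i j → h i j + v (i + 1ℤ) j ≡ v i j + h i (j + 1ℤ)
  closed i j with eq ← All.lookup P-surf-closed (x∈S (i , j))
    -- `wordAt` reads neighbours at `i + 0ℤ` and `j + 0ℤ`.
    rewrite ℤ.+-identityʳ i | ℤ.+-identityʳ j = eq

  Φ : Vector → Vector
  Φ (i , j) = - j , integral h v closed i j

  Φ-horizontal : ∀ u → Φ (u ⊕ (1ℤ , 0ℤ)) ≡ Φ u ⊕ (0ℤ , height (x u))
  Φ-horizontal (i , j) rewrite ℤ.+-identityʳ j =
    cong₂ _,_ (sym (ℤ.+-identityʳ (- j))) (integral-horizontal h v closed i j)

  Φ-vertical : ∀ u → Φ (u ⊕ (0ℤ , 1ℤ)) ≡ Φ u ⊕ (-1ℤ , rise (x u) (x (u ⊕ (0ℤ , 1ℤ))))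
  Φ-vertical (i , j) rewrite ℤ.+-identityʳ i =
    cong₂ _,_ (ℤ.neg-distrib-+ j 1ℤ) (integral-vertical h v closed i j)

  -- The entries follow the order of `σ-rules`; each rule image computes to `(0ℤ , height t)` or
  -- `(-1ℤ , rise t t′)`.
  Φ-potential : IsPotential σ-surf x Φ
  Φ-potential =
    horizontal ① ① ∷ horizontal ① ② ∷ horizontal ① ③ ∷ horizontal ② ① ∷
    horizontal ② ② ∷ horizontal ③ ① ∷ horizontal ③ ② ∷ horizontal ③ ③ ∷
    vertical ① ① ∷ vertical ① ② ∷ vertical ① ③ ∷ vertical ② ① ∷
    vertical ② ② ∷ vertical ② ③ ∷ vertical ③ ② ∷ vertical ③ ③ ∷ []
    where
    horizontal : ∀ t t′ u → x u ≡ t → x (u ⊕ (1ℤ , 0ℤ)) ≡ t′ →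
                 Φ (u ⊕ (1ℤ , 0ℤ)) ≡ Φ u ⊕ (0ℤ , height t)
    horizontal _ _ u refl _ = Φ-horizontal u
    vertical : ∀ t t′ u → x u ≡ t → x (u ⊕ (0ℤ , 1ℤ)) ≡ t′ →
               Φ (u ⊕ (0ℤ , 1ℤ)) ≡ Φ u ⊕ (-1ℤ , rise t t′)
    vertical _ _ u refl refl = Φ-vertical u

  -- Points of one row share the summand along column 0, so only sums of heights within the row are
  -- compared.
  Φ-mono-< : ∀ {i i′} j → i < i′ →
             proj₂ (Φ (i , j)) + height (x (i , j)) ≤ proj₂ (Φ (i′ , j))
  Φ-mono-< {i} {i′} j i<i′ = begin
    ∑ (v 0ℤ) j + ∑ row i + row i      ≡⟨ ℤ.+-assoc (∑ (v 0ℤ) j) (∑ row i) (row i) ⟩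
    ∑ (v 0ℤ) j + (∑ row i + row i)    ≤⟨ ℤ.+-monoʳ-≤ (∑ (v 0ℤ) j) row-mono ⟩
    ∑ (v 0ℤ) j + ∑ row i′             ∎
    where
    open ℤ.≤-Reasoning
    row : ℤ → ℤ
    row k = h k j
    row-mono : ∑ row i + row i ≤ ∑ row i′
    row-mono = ∑-mono-< row (λ k → height≥0 (x (k , j))) i<i′

  -- The image of the left cell ends, in the second coordinate, before that of the right cell
  -- begins.
  images-separated : ∀ {i i′ j z z′} → i < i′ →
                     z ∈ supp (σ-base (x (i , j))) → z′ ∈ supp (σ-base (x (i′ , j))) →
                     Φ (i , j) ⊕ z ≢ Φ (i′ , j) ⊕ z′
  images-separated {i} {i′} {j} {z} {z′} i<i′ z∈ z′∈ eq
    with _ , _ , z<h ← supp-base (x (i , j)) z∈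
       | _ , z′≥0 , _ ← supp-base (x (i′ , j)) z′∈ =
    ℤ.<-irrefl (cong proj₂ eq) (begin-strict
      proj₂ (Φ (i , j)) + proj₂ z                <⟨ ℤ.+-monoʳ-< (proj₂ (Φ (i , j))) z<h ⟩
      proj₂ (Φ (i , j)) + height (x (i , j))     ≤⟨ Φ-mono-< j i<i′ ⟩
      proj₂ (Φ (i′ , j))                         ≡⟨ ℤ.+-identityʳ _ ⟨
      proj₂ (Φ (i′ , j)) + 0ℤ                    ≤⟨ ℤ.+-monoʳ-≤ (proj₂ (Φ (i′ , j))) z′≥0 ⟩
      proj₂ (Φ (i′ , j)) + proj₂ z′              ∎)
    where open ℤ.≤-Reasoning

  images-disjoint : ∀ {u u′ z z′} →
                    z ∈ supp (σ-base (x u)) → z′ ∈ supp (σ-base (x u′)) →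
                    Φ u ⊕ z ≡ Φ u′ ⊕ z′ → u ≡ u′
  images-disjoint {i , j} {i′ , j′} {z} {z′} z∈ z′∈ eq with same-row
    where
    same-row : j ≡ j′
    -- Base images lie in the column with first coordinate 0, so the first coordinates reduce to
    -- `- j` and `- j′`.
    same-row = ℤ.neg-injective (∙-cancelʳ 0ℤ _ _ (subst₂ (λ a a′ → - j + a ≡ - j′ + a′)
      (proj₁ (supp-base (x (i , j)) z∈)) (proj₁ (supp-base (x (i′ , j′)) z′∈)) (cong proj₁ eq)))
  ... | refl with ℤ.<-cmp i i′
  ... | tri< i<i′ _ _ = contradiction eq (images-separated i<i′ z∈ z′∈)
  ... | tri≈ _ refl _ = refl
  ... | tri> _ _ i′<i = contradiction (sym eq) (images-separated i′<i z′∈ z∈)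

  non-overlapping : ∀ P → All (Agrees x) (cells P) → NonOverlappingAt σ-surf P
  non-overlapping P xP {[ u , t ]} {[ u′ , t′ ]} c∈ c′∈ c≢c′ γ (z∈ , z∈′)
    with z′ , z′∈ , eq ← ∈-translate (ω σ-surf {P} γ) (σ-base t′) z∈′
    with refl ← All.lookup xP c∈ | refl ← All.lookup xP c′∈ =
    -- Adding `Φ u` to a common point of the two supports places both images in the frame of `Φ`.
    c≢c′ (cong (λ w → [ w , x w ]) (images-disjoint z∈ z′∈ (begin
      Φ u ⊕ _                                ≡⟨ cong (Φ u ⊕_) eq ⟩
      Φ u ⊕ (ω σ-surf {P} γ ⊕ z′)            ≡⟨ ⊕-assoc (Φ u) (ω σ-surf {P} γ) z′ ⟨
      (Φ u ⊕ ω σ-surf {P} γ) ⊕ z′            ≡⟨ cong (_⊕ z′) (ω-increment Φ Φ-potential P xP γ) ⟨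
      Φ u′ ⊕ z′                              ∎)))
    where open ≡-Reasoning

proposition4p8 : ConsistentOn σ-surf (patt S-surf) × NonOverlappingOn σ-surf (patt S-surf)
proposition4p8 =
    (λ P (_ , x∈S , xP) _ →
      potential⇒consistent (Surface.Φ x∈S) (Surface.Φ-potential x∈S) P xP)
  , (λ P (_ , x∈S , xP) _ → Surface.non-overlapping x∈S P xP)
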